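{- Let $c\in(0,1]$ be a constant and let $\sigma,N\ge2$ be integers. Call an integer $m\ge2$ admissible if, for $\ell:=\lfloor c\log_\sigma m\rfloor$, it holds $\ell\ge1$ and $m\ell\le N$, and assume that an admissible $m$ exists. Any data structure supporting prefix select queries with ranks in $\{1,\dots,m\}$ for every admissible $m$ and every sequence $W[1..m]$ of $m$ strings over alphabet $[0..\sigma)$, each of length exactly $\ell=\lfloor c\log_\sigma m\rfloor$, has worst-case space usage $\Omega(N\log\sigma)$ bits (with the hidden constant depending on at most $c$).
   Context: Here $[0..\sigma)=\{0,\dots,\sigma-1\}$ and $\log$ without a base is base 2. For a sequence $W[1..m]$ of strings of length $\ell$, a string $X$ over $[0..\sigma)$ of length at most $\ell$, and $r\in\{1,\dots,m\}$, the prefix select query returns $\mathsf{prefix\text{ - }select}_W(r,X)$: the $r$th smallest element of $\{j\in\{1,\dots,m\}:X\text{ is a prefix of }W[j]\}$ if this set has at least $r$ elements, and $\infty$ otherwise. A data structure supporting a query problem for a family of inputs (with parameters $c,\sigma,N$ fixed) assigns to each input a finite bit string; the answer to every query on an input is determined by the stored bit string and the query arguments only. The space used on an input is the length of its bit string, and the worst-case space usage is the maximum over all inputs in the family. Query time is irrelevant. -}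

module Defs where

open import Data.Bool.Base using (Bool)
open import Data.Empty using (⊥)
open import Data.Fin.Base using (Fin; toℕ)
import Data.Fin.Properties as Fin
open import Data.Integer.Base using (+_; -[1+_])
open import Data.List.Base using (List; allFin; drop; filter; head; length; map)
open import Data.List.Relation.Binary.Prefix.Heterogeneous.Properties using (prefix?)
open import Data.Maybe.Base using (Maybe)
open import Data.Nat.Base as ℕ using (ℕ; suc; _∸_; _^_)
open import Data.Product.Base using (∃; ∃-syntax; _×_)
open import Data.Rational.Base as ℚ using (ℚ; 0ℚ; ↥_; ↧ₙ_)
open import Data.Sum.Base using (_⊎_)
open import Data.Unit.Base using (⊤)
open import Data.Vec.Base using (Vec; lookup; toList)
open import Relation.Binary.PropositionalEquality.Core using (_≡_)
open import Relation.Nullary.Negation.Core using (¬_)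

-- Real numbers are two-sided Dedekind cuts of ℚ: Lower x q means q < x and
-- Upper x q means x < q.  The operations below are defined on raw pairs of
-- predicates; IsReal collects the laws that make such a pair a real number.

record Cut : Set₁ where
  field
    Lower : ℚ → Set
    Upper : ℚ → Set

open Cut public

record IsReal (x : Cut) : Set where
  field
    lower-inhabited : ∃ (Lower x)
    upper-inhabited : ∃ (Upper x)
    lower-down      : ∀ {q r} → q ℚ.< r → Lower x r → Lower x q
    lower-open      : ∀ {q} → Lower x q → ∃[ r ] (q ℚ.< r × Lower x r)
    upper-up        : ∀ {q r} → q ℚ.< r → Upper x q → Upper x r
    upper-open      : ∀ {r} → Upper x r → ∃[ q ] (q ℚ.< r × Upper x q)
    disjoint        : ∀ {q} → ¬ (Lower x q × Upper x q)
    located         : ∀ {q r} → q ℚ.< r → Lower x q ⊎ Upper x r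

infix 4 _<ᵣ_ _≤ᵣ_

_<ᵣ_ : Cut → Cut → Set
x <ᵣ y = ∃[ q ] (Upper x q × Lower y q)

_≤ᵣ_ : Cut → Cut → Set
x ≤ᵣ y = ¬ (y <ᵣ x)

ℕ→ℚ : ℕ → ℚ
ℕ→ℚ n = + n ℚ./ 1

fromℚ : ℚ → Cut
fromℚ p = record { Lower = ℚ._< p ; Upper = p ℚ.<_ }

fromℕ : ℕ → Cut
fromℕ n = fromℚ (ℕ→ℚ n)

-- The logarithm of n ≥ 1 to base b ≥ 2.  It is nonnegative, and for p ≥ 0
-- exponentiation gives p/q < log_b n exactly when b^p < n^q.

log[_] : ℕ → ℕ → Cut
log[ b ] n = record { Lower = lower ; Upper = upper }
  where
  lower upper : ℚ → Set
  lower r with ↥ r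
  ... | + p      = b ^ p ℕ.< n ^ (↧ₙ r)
  ... | -[1+ _ ] = ⊤
  upper r with ↥ r
  ... | + p      = n ^ (↧ₙ r) ℕ.< b ^ p
  ... | -[1+ _ ] = ⊥

-- The product of two nonnegative reals (not meaningful for negative factors).

infixl 7 _·_

_·_ : Cut → Cut → Cut
x · y = record
  { Lower = λ q → q ℚ.< 0ℚ ⊎
      ∃[ r ] ∃[ s ] (0ℚ ℚ.≤ r × 0ℚ ℚ.≤ s × Lower x r × Lower y s × q ℚ.≤ r ℚ.* s)
  ; Upper = λ q →
      ∃[ r ] ∃[ s ] (Upper x r × Upper y s × r ℚ.* s ℚ.≤ q)
  }

-- k = ⌊ x ⌋ for nonnegative x.

IsFloor : Cut → ℕ → Set
IsFloor x k = fromℕ k ≤ᵣ x × x <ᵣ fromℕ (suc k)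

-- Positions are counted from 1, so index j : Fin m stands for position
-- suc (toℕ j).  allFin and filter keep the list in increasing order.

matches : ∀ {σ m ℓ} → Vec (Vec (Fin σ) ℓ) m → List (Fin σ) → List ℕ
matches {m = m} W X =
  map (λ j → suc (toℕ j))
      (filter (λ j → prefix? Fin._≟_ X (toList (lookup W j))) (allFin m))

-- Ranks r start at 1, and nothing stands for ∞.

prefixSelect : ∀ {σ m ℓ} → Vec (Vec (Fin σ) ℓ) m → ℕ → List (Fin σ) → Maybe ℕ
prefixSelect W r X = head (drop (r ∸ 1) (matches W X))

-- m is admissible, with ℓ = ⌊ c · log_σ m ⌋.

record IsAdmissible (c : Cut) (σ N m ℓ : ℕ) : Set where
  field
    m≥2   : 2 ℕ.≤ m
    floor : IsFloor (c · log[ σ ] m) ℓ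
    ℓ≥1   : 1 ℕ.≤ ℓ
    mℓ≤N  : m ℕ.* ℓ ℕ.≤ N

-- The admissibility proof is irrelevant, so that the encoding of an input
-- depends only on the string sequence (and its dimensions).

record Input (c : Cut) (σ N : ℕ) : Set where
  field
    m ℓ         : ℕ
    .admissible : IsAdmissible c σ N m ℓ
    W           : Vec (Vec (Fin σ) ℓ) m

record PrefixSelectStructure (c : Cut) (σ N : ℕ) : Set where
  field
    encode  : Input c σ N → List Bool
    answer  : List Bool → ℕ → List (Fin σ) → Maybe ℕ
    correct : ∀ (I : Input c σ N) (r : ℕ) (X : List (Fin σ)) →
              1 ℕ.≤ r → r ℕ.≤ Input.m I → length X ℕ.≤ Input.ℓ I →
              answer (encode I) r X ≡ prefixSelect (Input.W I) r X

  space : Input c σ N → ℕ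
  space I = length (encode I)

-- S is the maximum of the space usage over all inputs.

IsWorstCaseSpace : ∀ {c σ N} → PrefixSelectStructure c σ N → ℕ → Set
IsWorstCaseSpace D S =
  (∀ I → space I ℕ.≤ S) × ∃[ I ] space I ≡ S
  where open PrefixSelectStructure D

{-# OPTIONS --safe #-}
-- Fixing an admissible m, the full strings used as queries recover W, so the
-- encodings of the σ^(mℓ) inputs of that length are distinct bit strings and
-- σ^(mℓ) < 2^(S+1), whence mℓ · log₂ σ ≤ 2S.  It remains to find an admissible m
-- with N ≤ 6mℓ: as long as 6mℓ < N, also m + 1 is admissible, and this cannot go
-- on beyond m = N.  Floors of reals exist only up to double negation, which
-- suffices because _≤ᵣ_ is a negation.  The constant is κ = 1/12.
module Submission where

open import Defs
open import Data.Bool.Base using (Bool; true; false)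
open import Data.Fin.Base using (Fin; toℕ; fromℕ<; remQuot; combine)
import Data.Fin.Properties as Fin
open import Data.Integer.Base as ℤ using (+_; -[1+_])
import Data.Integer.Properties as ℤ
open import Data.List.Base using (List; []; _∷_; allFin; drop; filter; head; length)
open import Data.List.Membership.Propositional using (_∈_)
open import Data.List.Membership.Propositional.Properties
  using (∈-map⁺; ∈-map⁻; ∈-filter⁺; ∈-filter⁻; ∈-allFin)
open import Data.List.Properties using (length-map; length-filter; length-tabulate)
open import Data.List.Relation.Binary.Prefix.Heterogeneous using (Prefix; []; _∷_)
open import Data.List.Relation.Binary.Prefix.Heterogeneous.Properties using (prefix?)
open import Data.Maybe.Properties using (just-injective)
open import Data.Nat.Base as ℕ using (ℕ; zero; suc; _+_; _*_; _^_; _≤_; _<_; z≤n; s≤s; NonZero)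
open import Data.Nat.Binary.Base as ℕᵇ using (ℕᵇ; 2[1+_]; 1+[2_])
import Data.Nat.Binary.Properties as ℕᵇ
open import Data.Nat.Properties
open import Data.Nat.Tactic.RingSolver using (solve-∀)
open import Data.Product.Base using (∃-syntax; _×_; _,_; proj₁; proj₂)
open import Data.Rational.Base as ℚ using (ℚ; mkℚ; 0ℚ; toℚᵘ)
import Data.Rational.Properties as ℚ
open import Data.Rational.Unnormalised.Base as ℚᵘ using (mkℚᵘ; *≡*; *≤*)
import Data.Rational.Unnormalised.Properties as ℚᵘ
open import Data.Sum.Base using (inj₁; inj₂)
open import Data.Vec.Base using (Vec; []; _∷_; lookup; toList)
import Data.Vec.Properties as Vec
open import Function.Base using (_∘_)
open import Function.Definitions using (Injective)
open import Relation.Binary.PropositionalEquality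
open import Relation.Nullary.Decidable.Core using (yes; no)
open import Relation.Nullary.Negation.Core using (¬_; contradiction)

-- Enumerating vectors and counting bit strings.

-- The index is read as an `n`-digit number in base `a`, most significant digit first. Applied
-- twice, this enumerates first the strings and then the sequences of strings.
vectors : ∀ {A : Set} {a} → (Fin a → A) → ∀ n → Fin (a ^ n) → Vec A n
vectors f zero    _ = []
vectors {a = a} f (suc n) k with remQuot {a} (a ^ n) k
... | q , r = f q ∷ vectors f n r

vectors-injective : ∀ {A : Set} {a} {f : Fin a → A} → Injective _≡_ _≡_ f →
                    ∀ n → Injective _≡_ _≡_ (vectors f n)
vectors-injective f-inj zero {Fin.zero} {Fin.zero} _ = refl
vectors-injective {a = a} f-inj (suc n) {i} {j} eq =
  trans (sym (Fin.combine-remQuot {a} (a ^ n) i))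
    (trans (cong₂ combine (f-inj (Vec.∷-injectiveˡ eq))
                          (vectors-injective f-inj n (Vec.∷-injectiveʳ eq)))
           (Fin.combine-remQuot {a} (a ^ n) j))

-- Bijective base-2 numeration, with digits 1 and 2 and the least significant digit first. Having no
-- digit 0, it separates strings of different lengths without padding.
toBinary : List Bool → ℕᵇ
toBinary []           = ℕᵇ.zero
toBinary (false ∷ bs) = 1+[2 toBinary bs ]
toBinary (true  ∷ bs) = 2[1+ toBinary bs ]

toBinary-injective : Injective _≡_ _≡_ toBinary
toBinary-injective {[]}         {[]}         _  = refl
toBinary-injective {[]}         {false ∷ _}  ()
toBinary-injective {[]}         {true ∷ _}   ()
toBinary-injective {false ∷ bs} {false ∷ cs} eq =
  cong (false ∷_) (toBinary-injective (ℕᵇ.1+[2_]-injective eq))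
toBinary-injective {true ∷ bs}  {true ∷ cs}  eq =
  cong (true ∷_) (toBinary-injective (ℕᵇ.2[1+_]-injective eq))

-- The largest code at length n, that of the all-`true` string, is 2^(n+1) - 2. Adding 2 makes the
-- induction exact, as 2 + 2(1 + x) = 2(2 + x).
toBinary-bound : ∀ bs → 2 + ℕᵇ.toℕ (toBinary bs) ≤ 2 ^ suc (length bs)
toBinary-bound []           = ≤-refl
toBinary-bound (false ∷ bs) = ≤-trans
  (≤-trans (n≤1+n _) (≤-reflexive (lemma (ℕᵇ.toℕ (toBinary bs)))))
  (*-monoʳ-≤ 2 (toBinary-bound bs))
  where
  lemma : ∀ x → 4 + 2 * x ≡ 2 * (2 + x)
  lemma = solve-∀
toBinary-bound (true ∷ bs) = ≤-trans
  (≤-reflexive (lemma (ℕᵇ.toℕ (toBinary bs))))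
  (*-monoʳ-≤ 2 (toBinary-bound bs))
  where
  lemma : ∀ x → 2 + 2 * (1 + x) ≡ 2 * (2 + x)
  lemma = solve-∀

bitStrings-count : ∀ {a S} (f : Fin a → List Bool) → Injective _≡_ _≡_ f →
                   (∀ i → length (f i) ≤ S) → a < 2 ^ suc S
bitStrings-count {a} {S} f f-inj bound =
  m≤pred[n]⇒suc[m]≤n {{m^n≢0 2 (suc S)}} (Fin.injective⇒≤ {f = g} g-inj)
  where
  code : Fin a → ℕ
  code i = ℕᵇ.toℕ (toBinary (f i))
  -- The codes of strings of length at most `S` fill a range of size 2^(S+1) - 1; this `pred` makes
  -- the final inequality strict.
  code< : ∀ i → code i < ℕ.pred (2 ^ suc S)
  code< i = pred-mono-≤ (≤-trans (toBinary-bound (f i)) (^-monoʳ-≤ 2 (s≤s (bound i))))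
  g : Fin a → Fin (ℕ.pred (2 ^ suc S))
  g i = fromℕ< (code< i)
  g-inj : Injective _≡_ _≡_ g
  g-inj {i} {j} eq =
    f-inj (toBinary-injective (ℕᵇ.toℕ-injective (Fin.fromℕ<-injective _ _ (code< i) (code< j) eq)))

-- Recovering the sequence from its select answers.

-- Where one list has ended and the other has not, `nothing` meets `just`. The length bounds ensure
-- that this happens at an index below `n`, hence at a permitted rank.
drop-head-injective : ∀ {A : Set} n (xs ys : List A) → length xs ≤ n → length ys ≤ n →
                      (∀ i → i < n → head (drop i xs) ≡ head (drop i ys)) → xs ≡ ys
drop-head-injective n [] [] _ _ _ = refl
drop-head-injective (suc n) [] (y ∷ ys) _ _ eq with () ← eq 0 (s≤s z≤n)
drop-head-injective (suc n) (x ∷ xs) [] _ _ eq with () ← eq 0 (s≤s z≤n)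
drop-head-injective (suc n) (x ∷ xs) (y ∷ ys) (s≤s p) (s≤s q) eq =
  cong₂ _∷_ (just-injective (eq 0 (s≤s z≤n)))
    (drop-head-injective n xs ys p q (λ i i<n → eq (suc i) (s≤s i<n)))

prefix-refl : ∀ {A : Set} (xs : List A) → Prefix _≡_ xs xs
prefix-refl []       = []
prefix-refl (x ∷ xs) = refl ∷ prefix-refl xs

prefix⇒≡ : ∀ {A : Set} {n} (v w : Vec A n) → Prefix _≡_ (toList v) (toList w) → v ≡ w
prefix⇒≡ []      []       _        = refl
prefix⇒≡ (x ∷ v) (.x ∷ w) (refl ∷ p) = cong (x ∷_) (prefix⇒≡ v w p)

matches-length : ∀ {σ m ℓ} (W : Vec (Vec (Fin σ) ℓ) m) X → length (matches W X) ≤ m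
matches-length {m = m} W X = ≤-trans (≤-reflexive (length-map _ (filter P? (allFin m))))
  (≤-trans (length-filter P? (allFin m)) (≤-reflexive (length-tabulate {n = m} _)))
  where P? = λ j → prefix? Fin._≟_ X (toList (lookup W j))

matches⁺ : ∀ {σ m ℓ} (W : Vec (Vec (Fin σ) ℓ) m) X j →
           Prefix _≡_ X (toList (lookup W j)) → suc (toℕ j) ∈ matches W X
matches⁺ W X j p =
  ∈-map⁺ _ (∈-filter⁺ (λ j → prefix? Fin._≟_ X (toList (lookup W j))) (∈-allFin j) p)

matches⁻ : ∀ {σ m ℓ} (W : Vec (Vec (Fin σ) ℓ) m) X j →
           suc (toℕ j) ∈ matches W X → Prefix _≡_ X (toList (lookup W j))
matches⁻ {m = m} W X j j∈ with ∈-map⁻ _ j∈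
... | k , k∈ , eq with refl ← Fin.toℕ-injective (suc-injective eq) =
  proj₂ (∈-filter⁻ (λ j → prefix? Fin._≟_ X (toList (lookup W j))) {xs = allFin m} k∈)

-- Querying X = W[j] at all ranks yields the same matches in `W` and `V`. Position j is among them,
-- so W[j] is a prefix of V[j], and equal lengths make the two equal.
prefixSelect-injective : ∀ {σ m ℓ} (W V : Vec (Vec (Fin σ) ℓ) m) →
  (∀ r X → 1 ≤ r → r ≤ m → length X ≤ ℓ → prefixSelect W r X ≡ prefixSelect V r X) →
  W ≡ V
prefixSelect-injective {m = m} W V eq =
  trans (sym (Vec.tabulate∘lookup W)) (trans (Vec.tabulate-cong same) (Vec.tabulate∘lookup V))
  where
  same : ∀ j → lookup W j ≡ lookup V j
  same j = prefix⇒≡ _ _ (matches⁻ V X j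
    (subst (suc (toℕ j) ∈_) matches≡ (matches⁺ W X j (prefix-refl X))))
    where
    X = toList (lookup W j)
    matches≡ : matches W X ≡ matches V X
    matches≡ = drop-head-injective m _ _ (matches-length W X) (matches-length V X)
      (λ i i<m → eq (suc i) X (s≤s z≤n) i<m (≤-reflexive (Vec.length-toList (lookup W j))))

σ^ℓ^m<2^[1+S] : ∀ {c σ N m ℓ} → IsAdmissible c σ N m ℓ → (D : PrefixSelectStructure c σ N) →
        ∀ {S} → IsWorstCaseSpace D S → (σ ^ ℓ) ^ m < 2 ^ suc S
σ^ℓ^m<2^[1+S] {c} {σ} {N} {m} {ℓ} adm D (space≤S , _) =
  bitStrings-count (encode ∘ input ∘ W) encode∘W-inj (λ k → space≤S (input (W k)))
  where
  open PrefixSelectStructure D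
  W : Fin ((σ ^ ℓ) ^ m) → Vec (Vec (Fin σ) ℓ) m
  W = vectors (vectors (λ x → x) ℓ) m
  W-inj : Injective _≡_ _≡_ W
  W-inj = vectors-injective (vectors-injective (λ eq → eq) ℓ) m
  input : Vec (Vec (Fin σ) ℓ) m → Input c σ N
  input V = record { m = m ; ℓ = ℓ ; admissible = adm ; W = V }
  encode∘W-inj : Injective _≡_ _≡_ (encode ∘ input ∘ W)
  encode∘W-inj {i} {j} eq = W-inj (prefixSelect-injective _ _ λ r X 1≤r r≤m X≤ℓ →
    trans (sym (correct (input (W i)) r X 1≤r r≤m X≤ℓ))
      (trans (cong (λ b → answer b r X) eq) (correct (input (W j)) r X 1≤r r≤m X≤ℓ)))

-- Powers, and naturals as rationals.

^-cancelʳ-< : ∀ m {n o} .{{_ : NonZero m}} → m ^ n < m ^ o → n < o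
^-cancelʳ-< m m^n<m^o = ≰⇒> λ o≤n → <⇒≱ m^n<m^o (^-monoʳ-≤ m o≤n)

^-cancelˡ-< : ∀ n {m o} → m ^ n < o ^ n → m < o
^-cancelˡ-< n m^n<o^n = ≰⇒> λ o≤m → <⇒≱ m^n<o^n (^-monoˡ-≤ n o≤m)

-- `ℕ→ℚ n` is normalised by a gcd and does not compute for variable `n`; its unnormalised image has
-- an explicit numerator and denominator.
ℕ→ℚ-toℚᵘ : ∀ n → toℚᵘ (ℕ→ℚ n) ℚᵘ.≃ mkℚᵘ (+ n) 0
ℕ→ℚ-toℚᵘ n = ℚ.toℚᵘ-fromℚᵘ (mkℚᵘ (+ n) 0)

ℕ→ℚ-* : ∀ m n → ℕ→ℚ (m * n) ≡ ℕ→ℚ m ℚ.* ℕ→ℚ n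
ℕ→ℚ-* m n = ℚ.toℚᵘ-injective (begin
  toℚᵘ (ℕ→ℚ (m * n))                  ≈⟨ ℕ→ℚ-toℚᵘ (m * n) ⟩
  mkℚᵘ (+ (m * n)) 0                  ≡⟨ cong (λ z → mkℚᵘ z 0) (ℤ.pos-* m n) ⟩
  mkℚᵘ (+ m) 0 ℚᵘ.* mkℚᵘ (+ n) 0      ≈⟨ ℚᵘ.*-cong (ℕ→ℚ-toℚᵘ m) (ℕ→ℚ-toℚᵘ n) ⟨
  toℚᵘ (ℕ→ℚ m) ℚᵘ.* toℚᵘ (ℕ→ℚ n)      ≈⟨ ℚ.toℚᵘ-homo-* (ℕ→ℚ m) (ℕ→ℚ n) ⟨
  toℚᵘ (ℕ→ℚ m ℚ.* ℕ→ℚ n)              ∎)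
  where open import Relation.Binary.Reasoning.Setoid ℚᵘ.≃-setoid

ℕ→ℚ-mono-≤ : ∀ {m n} → m ≤ n → ℕ→ℚ m ℚ.≤ ℕ→ℚ n
ℕ→ℚ-mono-≤ {m} {n} m≤n = ℚ.toℚᵘ-cancel-≤ (begin
  toℚᵘ (ℕ→ℚ m)  ≃⟨ ℕ→ℚ-toℚᵘ m ⟩
  mkℚᵘ (+ m) 0  ≤⟨ *≤* (ℤ.*-monoʳ-≤-nonNeg (+ 1) (ℤ.+≤+ m≤n)) ⟩
  mkℚᵘ (+ n) 0  ≃⟨ ℕ→ℚ-toℚᵘ n ⟨
  toℚᵘ (ℕ→ℚ n)  ∎)
  where open ℚᵘ.≤-Reasoning

2ℚ : ℚ
2ℚ = ℕ→ℚ 2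

-- Upper bounds on logarithms.

log-Upper-double : ∀ {b n n′} s .{{_ : NonZero b}} → n′ ≤ n ^ 2 →
                   Upper (log[ b ] n) s → Upper (log[ b ] n′) (2ℚ ℚ.* s)
log-Upper-double {b} {n} {n′} s@(mkℚ (+ p) d-1 _) n′≤n² n^d<b^p =
  -- The reduced form of `2ℚ ℚ.* s` is unknown, so `go` takes any `t` = p′/d′ that equals 2p/d.
  go (2ℚ ℚ.* s) (ℚ.toℚᵘ-homo-* 2ℚ s)
  where
  d = suc d-1
  go : ∀ t → toℚᵘ t ℚᵘ.≃ mkℚᵘ (+ 2) 0 ℚᵘ.* mkℚᵘ (+ p) d-1 → Upper (log[ b ] n′) t
  -- Comparing `d`-th powers brings in the hypothesis n^d < b^p.
  go (mkℚ (+ p′) d′-1 _) (*≡* eq) = ^-cancelˡ-< d (begin-strict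
    (n′ ^ d′) ^ d         ≤⟨ ^-monoˡ-≤ d (^-monoˡ-≤ d′ n′≤n²) ⟩
    ((n ^ 2) ^ d′) ^ d    ≡⟨ cong (_^ d) (^-*-assoc n 2 d′) ⟩
    (n ^ (2 * d′)) ^ d    ≡⟨ ^-*-assoc n (2 * d′) d ⟩
    n ^ (2 * d′ * d)      ≡⟨ cong (n ^_) (*-comm (2 * d′) d) ⟩
    n ^ (d * (2 * d′))    ≡⟨ ^-*-assoc n d (2 * d′) ⟨
    (n ^ d) ^ (2 * d′)    <⟨ ^-monoˡ-< (2 * d′) n^d<b^p ⟩
    (b ^ p) ^ (2 * d′)    ≡⟨ ^-*-assoc b p (2 * d′) ⟩
    b ^ (p * (2 * d′))    ≡⟨ cong (b ^_) exponent ⟩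
    b ^ (p′ * d)          ≡⟨ ^-*-assoc b p′ d ⟨
    (b ^ p′) ^ d          ∎)
    where
    open ≤-Reasoning
    d′ = suc d′-1
    eqℕ : p′ * (1 * d) ≡ 2 * p * d′
    eqℕ = ℤ.+-injective (trans (ℤ.pos-* p′ (1 * d)) (trans eq
      (trans (cong (ℤ._* + d′) (sym (ℤ.pos-* 2 p))) (sym (ℤ.pos-* (2 * p) d′)))))
    exponent : p * (2 * d′) ≡ p′ * d
    exponent = trans (lemma p d′) (trans (sym eqℕ) (cong (p′ *_) (*-identityˡ d)))
      where
      lemma : ∀ x y → x * (2 * y) ≡ 2 * x * y
      lemma = solve-∀
  -- A negative `t` cannot equal 2p/d.
  go (mkℚ -[1+ p′ ] d′-1 _) (*≡* eq) = contradiction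
    (trans eq (trans (cong (ℤ._* + suc d′-1) (sym (ℤ.pos-* 2 p)))
                     (sym (ℤ.pos-* (2 * p) (suc d′-1)))))
    λ ()

log-Upper-antitone : ∀ {b n n′} s → n ≤ n′ → Upper (log[ b ] n′) s → Upper (log[ b ] n) s
log-Upper-antitone s@(mkℚ (+ p) d-1 _) n≤n′ = ≤-<-trans (^-monoˡ-≤ (suc d-1) n≤n′)

-- Floors and admissible lengths.

<ᵣ-fromℕ-mono : ∀ x {k l} → k ≤ l → x <ᵣ fromℕ k → x <ᵣ fromℕ l
<ᵣ-fromℕ-mono _ k≤l (q , x<q , q<k) = q , x<q , ℚ.<-≤-trans q<k (ℕ→ℚ-mono-≤ k≤l)

¬¬-floor : ∀ x ℓ n → fromℕ ℓ ≤ᵣ x → x <ᵣ fromℕ n → ¬ ¬ (∃[ k ] (ℓ ≤ k × k < n × IsFloor x k))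
¬¬-floor x ℓ n ℓ≤x x<n none = go n ≤-refl x<n
  where
  go : ∀ k → k ≤ n → ¬ (x <ᵣ fromℕ k)
  go zero    _   x<0 = ℓ≤x (<ᵣ-fromℕ-mono x {l = ℓ} z≤n x<0)
  go (suc k) k<n x<k+1 with ℓ ≤? k
  -- The recursive call proves `fromℕ k ≤ᵣ x`, so `k` would be the floor that `none` forbids.
  ... | yes ℓ≤k = none (k , ℓ≤k , k<n , go k (<⇒≤ k<n) , x<k+1)
  ... | no  ℓ≰k = ℓ≤x (<ᵣ-fromℕ-mono x {l = ℓ} (≰⇒> ℓ≰k) x<k+1)

-- As m + 1 ≤ m², passing from m to m + 1 at most doubles the logarithm, so the
-- floor becomes at most 2ℓ + 1 ≤ 3ℓ and (m + 1)ℓ′ ≤ 6mℓ.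
¬¬-admissible-suc : ∀ {c σ N m ℓ} → 2 ≤ σ → IsAdmissible c σ N m ℓ → 6 * (m * ℓ) < N →
                    ¬ ¬ (∃[ ℓ′ ] IsAdmissible c σ N (suc m) ℓ′)
¬¬-admissible-suc {c} {σ} {N} {m} {ℓ} 2≤σ adm small none =
  ¬¬-floor (c · log[ σ ] (suc m)) ℓ (2 * suc ℓ) lower upper λ where
    (ℓ′ , ℓ≤ℓ′ , ℓ′<2ℓ+2 , fl) → none (ℓ′ , record
      { m≥2 = m≤n⇒m≤1+n m≥2
      ; floor = fl
      ; ℓ≥1 = ≤-trans ℓ≥1 ℓ≤ℓ′
      ; mℓ≤N = begin
          suc m * ℓ′               ≤⟨ *-mono-≤ m+1≤2m (ℓ′≤3ℓ ℓ′<2ℓ+2) ⟩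
          (2 * m) * (3 * ℓ)        ≡⟨ lemma m ℓ ⟩
          6 * (m * ℓ)              ≤⟨ <⇒≤ small ⟩
          N                        ∎ })
  where
  open IsAdmissible adm
  open ≤-Reasoning
  lemma : ∀ x y → (2 * x) * (3 * y) ≡ 6 * (x * y)
  lemma = solve-∀
  lemma₂ : ∀ x → 2 * suc x ≡ suc (1 + 2 * x)
  lemma₂ = solve-∀
  m+1≤2m : suc m ≤ 2 * m
  m+1≤2m = +-mono-≤ (≤-trans (s≤s z≤n) m≥2) (≤-reflexive (sym (+-identityʳ m)))
  m+1≤m² : suc m ≤ m ^ 2
  m+1≤m² = ≤-trans m+1≤2m (≤-trans (*-monoˡ-≤ m m≥2) (*-monoʳ-≤ m (≤-reflexive (sym (*-identityʳ m)))))
  ℓ′≤3ℓ : ∀ {ℓ′} → ℓ′ < 2 * suc ℓ → ℓ′ ≤ 3 * ℓ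
  ℓ′≤3ℓ p = ≤-trans (ℕ.s≤s⁻¹ (≤-trans p (≤-reflexive (lemma₂ ℓ)))) (+-monoˡ-≤ (2 * ℓ) ℓ≥1)
  lower : fromℕ ℓ ≤ᵣ c · log[ σ ] (suc m)
  lower (q , (r , s , c<r , log<s , rs≤q) , q<ℓ) =
    proj₁ floor (q , (r , s , c<r , log-Upper-antitone s (n≤1+n m) log<s , rs≤q) , q<ℓ)
  upper : c · log[ σ ] (suc m) <ᵣ fromℕ (2 * suc ℓ)
  upper with proj₂ floor
  ... | q , (r , s , c<r , log<s , rs≤q) , q<ℓ+1 =
    -- Doubling only the logarithmic factor `s` doubles the product, and 2q < 2(ℓ + 1).
    2ℚ ℚ.* q ,
    (r , 2ℚ ℚ.* s , c<r ,
      log-Upper-double s {{ℕ.>-nonZero (≤-trans (s≤s z≤n) 2≤σ)}} m+1≤m² log<s ,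
      subst (ℚ._≤ 2ℚ ℚ.* q) r*2s (ℚ.*-monoˡ-≤-nonNeg 2ℚ rs≤q)) ,
    subst (2ℚ ℚ.* q ℚ.<_) (sym (ℕ→ℚ-* 2 (suc ℓ))) (ℚ.*-monoʳ-<-pos 2ℚ q<ℓ+1)
    where
    r*2s : 2ℚ ℚ.* (r ℚ.* s) ≡ r ℚ.* (2ℚ ℚ.* s)
    r*2s = trans (sym (ℚ.*-assoc 2ℚ r s))
      (trans (cong (ℚ._* s) (ℚ.*-comm 2ℚ r)) (ℚ.*-assoc r 2ℚ s))

¬¬-large-admissible : ∀ {c σ N m ℓ} → 2 ≤ σ → IsAdmissible c σ N m ℓ →
  ¬ ¬ (∃[ m′ ] ∃[ ℓ′ ] (IsAdmissible c σ N m′ ℓ′ × N ≤ 6 * (m′ * ℓ′)))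
¬¬-large-admissible {c} {σ} {N} 2≤σ adm none = climb N (m≤n+m N _) adm
  where
  -- `k` bounds the remaining distance from `m` to `N`; at 0, N ≤ m ≤ 6mℓ.
  climb : ∀ k {m ℓ} → N ≤ m + k → ¬ IsAdmissible c σ N m ℓ
  climb k {m} {ℓ} N≤m+k adm with N ≤? 6 * (m * ℓ)
  climb k N≤m+k adm | yes large = none (_ , _ , adm , large)
  climb zero {m} {ℓ} N≤m+k adm | no small = small (begin
    N            ≤⟨ N≤m+k ⟩
    m + 0        ≡⟨ +-identityʳ m ⟩
    m            ≤⟨ m≤m*n m ℓ {{ℕ.>-nonZero (IsAdmissible.ℓ≥1 adm)}} ⟩
    m * ℓ        ≤⟨ m≤n*m (m * ℓ) 6 ⟩
    6 * (m * ℓ)  ∎)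
    where open ≤-Reasoning
  climb (suc k) {m} N≤m+k adm | no small =
    ¬¬-admissible-suc 2≤σ adm (≰⇒> small) λ where
      (ℓ′ , adm′) → climb k (≤-trans N≤m+k (≤-reflexive (+-suc m k))) adm′

-- From the count to the space bound.

-- For s = p/d, 2^(pK) ≤ σ^(dK) < 2^(Ed) gives Ks < E, whence Ns ≤ aKs ≤ aE ≤ T.
log-Lower-bound : ∀ {σ K E N T} a s → σ ^ K < 2 ^ E → N ≤ a * K → a * E ≤ T → 0ℚ ℚ.≤ s →
                  Lower (log[ 2 ] σ) s → ℕ→ℚ N ℚ.* s ℚ.≤ ℕ→ℚ T
log-Lower-bound a (mkℚ -[1+ _ ] _ _) _ _ _ (ℚ.*≤* ()) _
log-Lower-bound {σ} {K} {E} {N} {T} a s@(mkℚ (+ p) d-1 _) σ^K<2^E N≤aK aE≤T _ 2^p<σ^d =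
  ℚ.toℚᵘ-cancel-≤ (begin
    toℚᵘ (ℕ→ℚ N ℚ.* s)            ≃⟨ ℚ.toℚᵘ-homo-* (ℕ→ℚ N) s ⟩
    toℚᵘ (ℕ→ℚ N) ℚᵘ.* toℚᵘ s      ≃⟨ ℚᵘ.*-congʳ (ℕ→ℚ-toℚᵘ N) ⟩
    mkℚᵘ (+ N) 0 ℚᵘ.* toℚᵘ s      ≤⟨ *≤* cross ⟩
    mkℚᵘ (+ T) 0                  ≃⟨ ℕ→ℚ-toℚᵘ T ⟨
    toℚᵘ (ℕ→ℚ T)                  ∎)
  where
  open ℚᵘ.≤-Reasoning
  d = suc d-1
  lemma : ∀ x y z → x * y * z ≡ x * (z * y)
  lemma = solve-∀
  lemma₂ : ∀ x y z → x * (y * z) ≡ x * y * (1 * z)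
  lemma₂ = solve-∀
  pK<Ed : p * K < E * d
  pK<Ed = ^-cancelʳ-< 2 (ℕR.begin-strict
    2 ^ (p * K)    ℕR.≡⟨ ^-*-assoc 2 p K ⟨
    (2 ^ p) ^ K    ℕR.≤⟨ ^-monoˡ-≤ K (<⇒≤ 2^p<σ^d) ⟩
    (σ ^ d) ^ K    ℕR.≡⟨ ^-*-assoc σ d K ⟩
    σ ^ (d * K)    ℕR.≡⟨ cong (σ ^_) (*-comm d K) ⟩
    σ ^ (K * d)    ℕR.≡⟨ ^-*-assoc σ K d ⟨
    (σ ^ K) ^ d    ℕR.<⟨ ^-monoˡ-< d σ^K<2^E ⟩
    (2 ^ E) ^ d    ℕR.≡⟨ ^-*-assoc 2 E d ⟩
    2 ^ (E * d)    ℕR.∎)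
    where module ℕR = ≤-Reasoning
  Np≤Td : N * p * 1 ≤ T * (1 * d)
  Np≤Td = ℕR.begin
    N * p * 1        ℕR.≡⟨ *-identityʳ (N * p) ⟩
    N * p            ℕR.≤⟨ *-monoˡ-≤ p N≤aK ⟩
    a * K * p        ℕR.≡⟨ lemma a K p ⟩
    a * (p * K)      ℕR.≤⟨ *-monoʳ-≤ a (<⇒≤ pK<Ed) ⟩
    a * (E * d)      ℕR.≡⟨ lemma₂ a E d ⟩
    a * E * (1 * d)  ℕR.≤⟨ *-monoˡ-≤ (1 * d) aE≤T ⟩
    T * (1 * d)      ℕR.∎
    where module ℕR = ≤-Reasoning
  cross : (+ N ℤ.* + p) ℤ.* + 1 ℤ.≤ + T ℤ.* + (1 * d)
  cross = subst₂ ℤ._≤_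
    (trans (ℤ.pos-* (N * p) 1) (cong (ℤ._* + 1) (ℤ.pos-* N p)))
    (ℤ.pos-* T (1 * d)) (ℤ.+≤+ Np≤Td)

corollary5p15 : (c : Cut) → IsReal c → fromℕ 0 <ᵣ c → c ≤ᵣ fromℕ 1 →
    ∃[ κ ] (0ℚ ℚ.< κ ×
    (∀ (σ N : ℕ) → 2 ℕ.≤ σ → 2 ℕ.≤ N →
    (∃[ m ] ∃[ ℓ ] IsAdmissible c σ N m ℓ) →
    (D : PrefixSelectStructure c σ N) (S : ℕ) → IsWorstCaseSpace D S →
    fromℚ (κ ℚ.* ℕ→ℚ N) · log[ 2 ] σ ≤ᵣ fromℕ S))
corollary5p15 c _ _ _ = κ , ℚ.positive⁻¹ κ , bound
  where
  κ : ℚ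
  -- A factor 6 is lost in N ≤ 6mℓ and a factor 2 in S + 1 ≤ 2S.
  κ = + 1 ℚ./ 12
  bound : ∀ σ N → 2 ≤ σ → 2 ≤ N → (∃[ m ] ∃[ ℓ ] IsAdmissible c σ N m ℓ) →
          (D : PrefixSelectStructure c σ N) (S : ℕ) → IsWorstCaseSpace D S →
          fromℚ (κ ℚ.* ℕ→ℚ N) · log[ 2 ] σ ≤ᵣ fromℕ S
  bound σ N _ _ _ D S _ (q , S<q , inj₁ q<0) =
    ℚ.<-irrefl refl (ℚ.≤-<-trans (ℕ→ℚ-mono-≤ {n = S} z≤n) (ℚ.<-trans S<q q<0))
  bound σ N 2≤σ _ (_ , _ , adm₀) D S isMax
    (q , S<q , inj₂ (r , s , _ , 0≤s , r<κN , s<log , q≤rs)) =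
    ¬¬-large-admissible 2≤σ adm₀ λ where
      (m , ℓ , adm , N≤6mℓ) → ℚ.<-irrefl refl (begin-strict
        ℕ→ℚ S                      <⟨ S<q ⟩
        q                          ≤⟨ q≤rs ⟩
        r ℚ.* s                    ≤⟨ ℚ.*-monoʳ-≤-nonNeg s {{ℚ.nonNegative 0≤s}} (ℚ.<⇒≤ r<κN) ⟩
        κ ℚ.* ℕ→ℚ N ℚ.* s          ≡⟨ ℚ.*-assoc κ (ℕ→ℚ N) s ⟩
        κ ℚ.* (ℕ→ℚ N ℚ.* s)        ≤⟨ ℚ.*-monoˡ-≤-nonNeg κ (Ns≤12S adm N≤6mℓ) ⟩
        κ ℚ.* ℕ→ℚ (12 * S)         ≡⟨ cong (κ ℚ.*_) (ℕ→ℚ-* 12 S) ⟩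
        κ ℚ.* (ℕ→ℚ 12 ℚ.* ℕ→ℚ S)   ≡⟨ ℚ.*-assoc κ (ℕ→ℚ 12) (ℕ→ℚ S) ⟨
        -- `κ ℚ.* ℕ→ℚ 12` is closed and evaluates to 1.
        ℚ.1ℚ ℚ.* ℕ→ℚ S             ≡⟨ ℚ.*-identityˡ (ℕ→ℚ S) ⟩
        ℕ→ℚ S                      ∎)
    where
    open ℚ.≤-Reasoning
    lemma : ∀ x → 6 * (x + x) ≡ 12 * x
    lemma = solve-∀
    Ns≤12S : ∀ {m ℓ} → IsAdmissible c σ N m ℓ → N ≤ 6 * (m * ℓ) → ℕ→ℚ N ℚ.* s ℚ.≤ ℕ→ℚ (12 * S)
    Ns≤12S {m} {ℓ} adm N≤6mℓ = log-Lower-bound {K = m * ℓ} 6 s σ^mℓ<2^[S+1] N≤6mℓ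
      (≤-trans (*-monoʳ-≤ 6 S+1≤2S) (≤-reflexive (lemma S))) 0≤s s<log
      where
      open IsAdmissible adm
      σ^mℓ<2^[S+1] : σ ^ (m * ℓ) < 2 ^ suc S
      σ^mℓ<2^[S+1] = subst (_< 2 ^ suc S)
        (trans (^-*-assoc σ ℓ m) (cong (σ ^_) (*-comm ℓ m))) (σ^ℓ^m<2^[1+S] adm D isMax)
      -- Since σ ≥ 2, 2^(mℓ) < 2^(S+1). With mℓ ≥ 1 this yields S ≥ 1, which absorbs the 1 in S + 1.
      mℓ≤S : m * ℓ ≤ S
      mℓ≤S = ℕ.s≤s⁻¹ (^-cancelʳ-< 2 (≤-<-trans (^-monoˡ-≤ (m * ℓ) 2≤σ) σ^mℓ<2^[S+1]))
      S+1≤2S : suc S ≤ S + S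
      S+1≤2S = +-monoˡ-≤ S (≤-trans (*-mono-≤ (≤-trans (s≤s z≤n) m≥2) ℓ≥1) mℓ≤S)
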